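{- For every $k\in\mathbb{N}$ there exists an $\mathrm{MSO}_1$ sentence $\phi_k$ such that for every graph $G$, it holds that $G\models\phi_k$ if and only if $G$ is a YES-instance of Strong Rainbow Vertex $k$-Coloring ($k$-SRVC). Similarly, for every $k\in\mathbb{N}$ there exists an $\mathrm{MSO}_2$ sentence $\psi_k$ such that for every graph $G$, it holds that $G\models\psi_k$ if and only if $G$ is a YES-instance of Strong Rainbow $k$-Coloring ($k$-SRC).
   Context: All graphs are finite, simple and undirected. $[i]=\{1,\dots,i\}$. A vertex (edge) coloring of $G=(V,E)$ is a mapping from $V$ (from $E$) to $\mathbb{N}$, not necessarily proper. A color occurs on a path $P$ if it is the color of an edge of $P$ (for edge colorings), respectively of an internal vertex of $P$ (for vertex colorings). A vertex or edge coloring is a strong rainbow coloring if between each pair of vertices $a,b$ there exists a shortest $a$–$b$ path on which each color occurs at most once. $\mathrm{src}(G)$ (resp. $\mathrm{srvc}(G)$) is the minimum $i\in\mathbb{N}$ such that there is a strong rainbow edge coloring $\alpha:E\to[i]$ (resp. strong rainbow vertex coloring $\alpha:V\to[i]$). $k$-SRC: given a connected graph $G$, is $\mathrm{src}(G)\le k$? $k$-SRVC: given a connected graph $G$, is $\mathrm{srvc}(G)\le k$? In particular, a YES-instance is a connected graph satisfying the respective inequality. $\mathrm{MSO}_2$ formulas are built from atomic formulas $I(x,y)$ (vertex $x$ is incident to edge $y$), $x\in X$, $x=y$ using negation, conjunction, existential quantification over individual variables (ranging over vertices and edges) and over set variables (ranging over sets of vertices or sets of edges). $\mathrm{MSO}_1$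 is defined similarly, but individual variables range only over vertices, set variables only over sets of vertices, and $I(x,y)$ is replaced by $E(x,y)$ (vertices $x$ and $y$ are adjacent). A sentence is a formula without free variables. -}

module Defs where

open import Data.Bool using (Bool; T)
open import Data.Empty using (⊥)
open import Data.Fin using (Fin; _<_)
open import Data.Fin.Subset using (Subset; _∈_)
open import Data.List using (List; []; _∷_; length; map)
open import Data.List.Relation.Unary.Unique.Propositional using (Unique)
open import Data.Nat using (ℕ; suc; _≤_)
open import Data.Product using (Σ; ∃; ∃-syntax; _×_)
open import Data.Sum using (_⊎_; inj₁; inj₂)
open import Data.Vec as Vec using (Vec; lookup)
open import Relation.Binary.PropositionalEquality using (_≡_)
open import Relation.Nullary using (¬_)

record Graph : Set where
  field
    order      : ℕ
    adjacent   : Fin order → Fin order → Bool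
    symmetric  : ∀ u v → T (adjacent u v) → T (adjacent v u)
    loopless   : ∀ v → ¬ T (adjacent v v)

  Vertex : Set
  Vertex = Fin order

  infix 4 _~_

  _~_ : Vertex → Vertex → Set
  u ~ v = T (adjacent u v)

  -- An unordered pair of adjacent vertices, stored in increasing order.
  -- The proofs are irrelevant, so _≡_ on edges is equality of endpoints.
  record Edge : Set where
    constructor edge
    field
      lower    : Vertex
      upper    : Vertex
      .ordered : lower < upper
      .joined  : lower ~ upper

  open Edge public

  Joins : Edge → Vertex → Vertex → Set
  Joins e u v = (lower e ≡ u × upper e ≡ v) ⊎ (lower e ≡ v × upper e ≡ u)

  Incident : Vertex → Edge → Set
  Incident v e = v ≡ lower e ⊎ v ≡ upper e

open Graph using (Vertex; Edge)

module _ (G : Graph) where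

  data Walk : Vertex G → Vertex G → Set where
    stop : ∀ {u} → Walk u u
    step : ∀ {u v w} (e : Edge G) → Graph.Joins G e u v → Walk v w → Walk u w

module _ {G : Graph} where

  edges : ∀ {a b} → Walk G a b → List (Edge G)
  edges stop         = []
  edges (step e _ p) = e ∷ edges p

  vertices : ∀ {a b} → Walk G a b → List (Vertex G)
  vertices {a} stop         = a ∷ []
  vertices {a} (step _ _ p) = a ∷ vertices p

  -- All vertices of the walk but the last one.
  departures : ∀ {a b} → Walk G a b → List (Vertex G)
  departures stop             = []
  departures {a} (step _ _ p) = a ∷ departures p

  internalVertices : ∀ {a b} → Walk G a b → List (Vertex G)
  internalVertices stop         = []
  internalVertices (step _ _ p) = departures p

  walkLength : ∀ {a b} → Walk G a b → ℕ
  walkLength p = length (edges p)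

  IsPath : ∀ {a b} → Walk G a b → Set
  IsPath p = Unique (vertices p)

  IsShortestPath : ∀ {a b} → Walk G a b → Set
  IsShortestPath {a} {b} p =
    IsPath p × (∀ (q : Walk G a b) → IsPath q → walkLength p ≤ walkLength q)

Connected : Graph → Set
Connected G = ∀ a b → Σ (Walk G a b) IsPath

module _ (G : Graph) where

  IsStrongRainbowEdgeColoring : {C : Set} → (Edge G → C) → Set
  IsStrongRainbowEdgeColoring α =
    ∀ a b → ∃[ p ] IsShortestPath {G} {a} {b} p × Unique (map α (edges p))

  IsStrongRainbowVertexColoring : {C : Set} → (Vertex G → C) → Set
  IsStrongRainbowVertexColoring α =
    ∀ a b → ∃[ p ] IsShortestPath {G} {a} {b} p × Unique (map α (internalVertices p))

IsMinimum : (ℕ → Set) → ℕ → Set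
IsMinimum P i = P i × (∀ j → P j → i ≤ j)

-- src and srvc are relations, since they are undefined on disconnected graphs.

IsSrc : Graph → ℕ → Set
IsSrc G = IsMinimum λ i → ∃[ α ] IsStrongRainbowEdgeColoring G {Fin i} α

IsSrvc : Graph → ℕ → Set
IsSrvc G = IsMinimum λ i → ∃[ α ] IsStrongRainbowVertexColoring G {Fin i} α

SRC : ℕ → Graph → Set
SRC k G = Connected G × ∃[ i ] IsSrc G i × i ≤ k

SRVC : ℕ → Graph → Set
SRVC k G = Connected G × ∃[ i ] IsSrvc G i × i ≤ k

data Logic : Set where
  MSO₁ MSO₂ : Logic

-- Formula L m n: formulas of L whose free variables are among m individual
-- variables and n set variables (two separate de Bruijn contexts).

data Formula : Logic → ℕ → ℕ → Set where
  E    : ∀ {m n}   → Fin m → Fin m → Formula MSO₁ m n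
  I    : ∀ {m n}   → Fin m → Fin m → Formula MSO₂ m n
  _∈′_ : ∀ {L m n} → Fin m → Fin n → Formula L m n
  _≡′_ : ∀ {L m n} → Fin m → Fin m → Formula L m n
  ¬′_  : ∀ {L m n} → Formula L m n → Formula L m n
  _∧′_ : ∀ {L m n} → Formula L m n → Formula L m n → Formula L m n
  ∃ᵢ_  : ∀ {L m n} → Formula L (suc m) n → Formula L m n
  ∃ₛ_  : ∀ {L m n} → Formula L m (suc n) → Formula L m n

Sentence : Logic → Set
Sentence L = Formula L 0 0

-- In MSO₂ variables are unsorted: an individual variable ranges over vertices
-- and edges together, and a set never mixes the two.

Individual : Logic → Graph → Set
Individual MSO₁ G = Vertex G
Individual MSO₂ G = Vertex G ⊎ Edge G

SetOf : Logic → Graph → Set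
SetOf MSO₁ G = Subset (Graph.order G)
SetOf MSO₂ G = Subset (Graph.order G) ⊎ (Edge G → Bool)

Member : ∀ L G → Individual L G → SetOf L G → Set
Member MSO₁ G v        X        = v ∈ X
Member MSO₂ G (inj₁ v) (inj₁ X) = v ∈ X
Member MSO₂ G (inj₂ e) (inj₂ X) = T (X e)
Member MSO₂ G (inj₁ _) (inj₂ _) = ⊥
Member MSO₂ G (inj₂ _) (inj₁ _) = ⊥

Incidence : ∀ G → Individual MSO₂ G → Individual MSO₂ G → Set
Incidence G (inj₁ v) (inj₂ e) = Graph.Incident G v e
Incidence G (inj₁ _) (inj₁ _) = ⊥
Incidence G (inj₂ _) _        = ⊥

Satisfies : ∀ {L m n} (G : Graph) → Vec (Individual L G) m → Vec (SetOf L G) n →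
            Formula L m n → Set
Satisfies         G ρ σ (E x y)  = Graph._~_ G (lookup ρ x) (lookup ρ y)
Satisfies         G ρ σ (I x y)  = Incidence G (lookup ρ x) (lookup ρ y)
Satisfies {L = L} G ρ σ (x ∈′ X) = Member L G (lookup ρ x) (lookup σ X)
Satisfies         G ρ σ (x ≡′ y) = lookup ρ x ≡ lookup ρ y
Satisfies         G ρ σ (¬′ φ)   = ¬ Satisfies G ρ σ φ
Satisfies         G ρ σ (φ ∧′ ψ) = Satisfies G ρ σ φ × Satisfies G ρ σ ψ
Satisfies         G ρ σ (∃ᵢ φ)   = ∃[ x ] Satisfies G (x Vec.∷ ρ) σ φ
Satisfies         G ρ σ (∃ₛ φ)   = ∃[ X ] Satisfies G ρ (X Vec.∷ σ) φ

infix 4 _⊨_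

_⊨_ : ∀ {L} → Graph → Sentence L → Set
G ⊨ φ = Satisfies G Vec.[] Vec.[] φ

{-# OPTIONS --safe #-}

-- On a rainbow path at most k items are colored, so in a graph that has a
-- strong rainbow coloring with k colors all distances are at most k + 1. "Some
-- shortest path is rainbow" is therefore a disjunction over the bounded path
-- lengths, and the coloring itself is quantified as a tuple of k sets. Both
-- logics are treated at once: the items are the vertices for MSO₁ and the edges
-- for MSO₂. Satisfaction in a finite graph is decidable, which justifies the
-- classical encodings of ∀ and ∨ and makes the least number of colors computable.

module Submission where

open import Data.Bool using (Bool; T; T?)
open import Data.Bool.Properties using (T-≡)
open import Data.Empty using (⊥-elim)
open import Data.Fin as Fin using (Fin; zero; suc; toℕ; fromℕ<; combine; inject≤; _<_; _<?_)
open import Data.Fin.Properties as Fin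
  using (any?; <-cmp; pigeonhole; combine-injective; toℕ<n; toℕ-fromℕ<; inject≤-injective)
open import Data.Fin.Subset using (Subset; _∈_)
open import Data.Fin.Subset.Properties using (_∈?_; anySubset?)
open import Data.List as List using (List; []; _∷_; length; map; tabulate)
open import Data.List.Properties using (length-map)
import Data.List.Membership.DecPropositional as DecMembership
open import Data.List.Membership.Propositional.Properties using (∈-lookup)
open import Data.List.Membership.Propositional using () renaming (_∈_ to _∈ₗ_)
open import Data.List.Relation.Unary.All as All using (All; []; _∷_)
import Data.List.Relation.Unary.All.Properties as All
open import Data.List.Relation.Unary.AllPairs as AllPairs using (AllPairs; []; _∷_)
import Data.List.Relation.Unary.AllPairs.Properties as AllPairs
open import Data.List.Relation.Unary.Any as Any using (Any; here; there)
import Data.List.Relation.Unary.Any.Properties as Any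
open import Data.List.Relation.Unary.Unique.Propositional using (Unique)
open import Data.Nat as ℕ using (ℕ; zero; suc; _*_; _≤_; z≤n; s≤s; s≤s⁻¹)
open import Data.Nat.Induction using (<-rec)
open import Data.Nat.Properties as ℕ
  using (≤-refl; ≤-trans; <⇒≤; ≮⇒≥; <⇒≱; m≤n⇒m≤1+n; suc-injective; anyUpTo?)
open import Data.Product using (Σ; ∃; ∃-syntax; _×_; _,_; proj₁; proj₂)
open import Data.Sum using (_⊎_; inj₁; inj₂; [_,_]′)
open import Data.Sum.Properties using (inj₁-injective; ≡-dec)
open import Data.Vec as Vec using (Vec; []; _∷_; lookup)
open import Data.Vec.Properties using (lookup∘tabulate; []=⇒lookup; lookup⇒[]=)
open import Function using (_∘_; _∘′_; id; _on_; case_of_)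
open import Function.Bundles using (_⇔_; mk⇔; Equivalence)
open import Function.Construct.Composition using (_⇔-∘_)
open import Function.Construct.Identity using (⇔-id)
open import Relation.Binary.Definitions using (DecidableEquality; tri<; tri≈; tri>)
open import Relation.Binary.PropositionalEquality
  using (_≡_; _≢_; refl; sym; trans; cong; subst)
open import Relation.Nullary using (¬_; Dec; yes; no; contradiction)
open import Relation.Nullary.Decidable as Dec
  using (map′; ¬?; _×-dec_; _⊎-dec_; ⌊_⌋; toWitness; fromWitness; decidable-stable; recompute)
open import Relation.Unary using (Decidable)
open import Defs

open Equivalence using (to; from)

private variable
  L : Logic
  k l m n : ℕ

-- Vertex and edge colorings as one notion.

Item : Logic → Graph → Set
Item MSO₁ = Graph.Vertex
Item MSO₂ = Graph.Edge

coloured : ∀ L {G a b} → Walk G a b → List (Item L G)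
coloured MSO₁ = internalVertices
coloured MSO₂ = edges

IsStrongRainbow : ∀ L G {C : Set} → (Item L G → C) → Set
IsStrongRainbow L G α =
  ∀ a b → ∃[ p ] IsShortestPath {G} {a} {b} p × Unique (map α (coloured L p))

Colourable : Logic → Graph → ℕ → Set
Colourable L G i = ∃[ α ] IsStrongRainbow L G {Fin i} α

-- Unfolds definitionally to `SRVC k G` for `MSO₁` and to `SRC k G` for `MSO₂`.
YesInstance : Logic → ℕ → Graph → Set
YesInstance L k G = Connected G × ∃[ i ] IsMinimum (Colourable L G) i × i ≤ k

-- Formulas

-- A tautology without free variables or sets, valid even when there are no individuals.
⊤′ : Formula L m n
⊤′ = ¬′ (∃ᵢ (¬′ (zero ≡′ zero)))

⋀ : List (Formula L m n) → Formula L m n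
⋀ []       = ⊤′
⋀ (φ ∷ φs) = φ ∧′ ⋀ φs

⋁ : List (Formula L m n) → Formula L m n
⋁ φs = ¬′ ⋀ (map ¬′_ φs)

-- The individuals of `MSO₂` are unsorted. Edges are recognized by having an incident vertex, and
-- vertices are the remaining individuals.
isItem : Fin m → Formula L m n
isItem {L = MSO₁} x = ⊤′
isItem {L = MSO₂} x = ∃ᵢ (I zero (suc x))

isVertex : Fin m → Formula L m n
isVertex {L = MSO₁} x = ⊤′
isVertex {L = MSO₂} x = ¬′ isItem x

∀ᵥ_ : Formula L (suc m) n → Formula L m n
∀ᵥ φ = ¬′ (∃ᵢ (isVertex zero ∧′ (¬′ φ)))

∀ₒ_ : Formula L (suc m) n → Formula L m n
∀ₒ φ = ¬′ (∃ᵢ (isItem zero ∧′ (¬′ φ)))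

∃ₛ^ : ∀ k → Formula L m k → Formula L m 0
∃ₛ^ zero    φ = φ
∃ₛ^ (suc k) φ = ∃ₛ^ k (∃ₛ φ)

-- The step from a to x is labelled by the item o that it contributes: its
-- departure a for vertex colorings, its edge for edge colorings.
arrow : Fin m → Fin m → Fin m → Formula L m n
arrow {L = MSO₁} a o x = (o ≡′ a) ∧′ E a x
arrow {L = MSO₂} a o x = (I a o ∧′ I x o) ∧′ (¬′ (a ≡′ x))

-- Inside `φ`, index 0 is the vertex reached, index 1 is the label of the step, and all older
-- indices are shifted by two.
via : Fin m → Formula L (suc (suc m)) n → Formula L m n
via a φ = ∃ᵢ (∃ᵢ (arrow (suc (suc a)) (suc zero) zero ∧′ φ))

walk : ℕ → Fin m → Fin m → Formula L m n
walk zero    a b = a ≡′ b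
walk (suc l) a b = via a (walk l zero (suc (suc b)))

-- The color sets are required to cover the items but may overlap. Apart items
-- share no set, so they receive distinct colors whichever covering set is chosen.
apart : Fin m → Fin m → Formula L m n
apart x y = ⋀ (tabulate λ i → ¬′ ((x ∈′ i) ∧′ (y ∈′ i)))

-- us holds the labels of the steps already taken.
labelRainbow : ℕ → List (Fin m) → Fin m → Fin m → Formula L m n
labelRainbow zero    us a b = a ≡′ b
labelRainbow (suc l) us a b =
  via a (⋀ (map (λ y → apart y (suc zero)) us′)
         ∧′ labelRainbow l (suc zero ∷ us′) zero (suc (suc b)))
  where us′ = map (λ y → suc (suc y)) us

-- For vertex colorings the first step leaves its label unrecorded: the start is not an internal
-- vertex, and the later departures are exactly the internal ones.
rainbow : ℕ → Fin m → Fin m → Formula L m n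
rainbow {L = MSO₁} zero    a b = a ≡′ b
rainbow {L = MSO₁} (suc l) a b = via a (labelRainbow l [] zero (suc (suc b)))
rainbow {L = MSO₂} l       a b = labelRainbow l [] a b

-- Speaks of walks only, since a walk of least length is automatically a path.
shortestRainbow : ℕ → Fin m → Fin m → Formula L m n
shortestRainbow l a b = rainbow l a b ∧′ ⋀ (tabulate {n = l} λ i → ¬′ walk (toℕ i) a b)

inColour : ∀ k → List (Formula L (suc m) k)
inColour k = tabulate λ i → zero ∈′ i

-- k + 1 bounds the length: at most k items on the path are colored, and for
-- vertex colorings the first departure is not among them.
shortestRainbows : ∀ k → List (Formula L (suc (suc m)) n)
shortestRainbows k = tabulate {n = suc (suc k)} λ l → shortestRainbow (toℕ l) (suc zero) zero

sentence : ∀ L → ℕ → Sentence L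
sentence L k = ∃ₛ^ k
  ((∀ₒ ⋁ (inColour k)) ∧′ (∀ᵥ (∀ᵥ ⋁ (shortestRainbows k))))

-- Walks

AllPairs-lookup : ∀ {A : Set} {R : A → A → Set} {xs} → AllPairs R xs →
                  ∀ {i j} → i < j → R (List.lookup xs i) (List.lookup xs j)
AllPairs-lookup {xs = _ ∷ _} (px ∷ _)   {zero}  {suc j} _   = All.lookup px (∈-lookup j)
AllPairs-lookup {xs = _ ∷ _} (_  ∷ pxs) {suc i} {suc j} i<j = AllPairs-lookup pxs (s≤s⁻¹ i<j)

Unique⇒length≤ : (xs : List (Fin k)) → Unique xs → length xs ≤ k
Unique⇒length≤ xs xs! = ≮⇒≥ λ k< →
  let i , j , i<j , eq = pigeonhole k< (List.lookup xs) in AllPairs-lookup xs! i<j eq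

module _ {G : Graph} where
  open Graph G

  -- Serves to cut out the detour when a walk returns to its starting vertex.
  suffix : ∀ {a b c} (p : Walk G a b) → IsPath {G} p → c ∈ₗ vertices {G} p →
           ∃[ q ] IsPath {G} {c} {b} q × walkLength {G} q ≤ walkLength {G} p
  suffix stop         !p        (here refl) = stop , !p , ≤-refl
  suffix (step e j p) !p        (here refl) = step e j p , !p , ≤-refl
  suffix (step e j p) (_ ∷ !p)  (there c∈)  =
    let q , !q , q≤p = suffix p !p c∈ in q , !q , m≤n⇒m≤1+n q≤p

  -- Induction from the end of the walk. Putting a new first step before a path keeps it a path,
  -- unless the new start already lies on it; then the suffix from that vertex is strictly shorter
  -- than the extended walk.
  path-or-shorter : ∀ {a b} (p : Walk G a b) →
                    IsPath {G} p ⊎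
                    ∃[ q ] IsPath {G} q × walkLength {G} {a} {b} q ℕ.< walkLength {G} p
  path-or-shorter stop = inj₁ ([] ∷ [])
  path-or-shorter {a} (step e j p) = shorten (path-or-shorter p)
    where
    open DecMembership Fin._≟_ using () renaming (_∈?_ to _∈ₗ?_)
    extend : ∀ q → IsPath {G} q → walkLength {G} q ≤ walkLength {G} p →
             (∃[ r ] IsPath {G} r × walkLength {G} r ℕ.< suc (walkLength {G} p))
             ⊎ IsPath {G} (step e j q)
    extend q !q q≤p with a ∈ₗ? vertices {G} q
    ... | yes a∈ = let r , !r , r≤q = suffix q !q a∈ in inj₁ (r , !r , s≤s (≤-trans r≤q q≤p))
    ... | no  a∉ = inj₂ (All.¬Any⇒All¬ _ a∉ ∷ !q)
    shorten : _ → _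
    shorten (inj₁ !p) = [ inj₂ , inj₁ ]′ (extend p !p ≤-refl)
    shorten (inj₂ (q , !q , q<p)) =
      inj₂ ([ id , (λ !eq → step e j q , !eq , s≤s q<p) ]′ (extend q !q (<⇒≤ q<p)))

  -- Every walk is bounded below by some path, so minimality among paths extends to walks.
  -- Conversely, a minimal walk that repeated a vertex would be beaten by a strictly shorter path.
  IsShortestPath⇔shortestWalk : ∀ {a b} (p : Walk G a b) →
    IsShortestPath {G} p ⇔ (∀ q → walkLength {G} p ≤ walkLength {G} q)
  IsShortestPath⇔shortestWalk p = mk⇔
    (λ (_ , min) q → [ min q , (λ (r , !r , r<q) → ≤-trans (min r !r) (<⇒≤ r<q)) ]′
                     (path-or-shorter q))
    (λ min → [ id , (λ (r , _ , r<p) → contradiction (min r) (<⇒≱ r<p)) ]′ (path-or-shorter p)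
           , λ q _ → min q)

  length-departures : ∀ {a b} (p : Walk G a b) → length (departures {G} p) ≡ walkLength {G} p
  length-departures stop         = refl
  length-departures (step _ _ p) = cong suc (length-departures p)

  -- A nonempty walk has one more edge than internal vertices. This gives one length bound for both
  -- logics.
  length≤1+coloured : ∀ L {a b} (p : Walk G a b) →
                      walkLength {G} p ≤ suc (length (coloured L {G} p))
  length≤1+coloured MSO₁ stop         = z≤n
  length≤1+coloured MSO₁ (step _ _ p) = s≤s (ℕ.≤-reflexive (sym (length-departures p)))
  length≤1+coloured MSO₂ p            = ℕ.n≤1+n _

-- Decidability of satisfaction

module _ {G : Graph} where
  open Graph G

  anyEdge? : {P : Edge → Set} → Decidable P → Dec (∃ P)
  anyEdge? {P} P? = map′
    (λ (u , v , (u<v , u~v) , p) → edge u v u<v u~v , p)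
    -- The proofs stored in an edge are irrelevant; `recompute` regains usable ones from the
    -- decision procedures.
    (λ { (edge u v u<v u~v , p) →
         u , v , (recompute (u <? v) u<v , recompute (T? (adjacent u v)) u~v) , p })
    (any? λ u → any? λ v → edgeBetween? u v)
    where
    edgeBetween? : ∀ u v → Dec (Σ (u < v × u ~ v) λ (u<v , u~v) → P (edge u v u<v u~v))
    edgeBetween? u v with (u <? v) ×-dec T? (adjacent u v)
    ... | yes h = map′ (h ,_) proj₂ (P? _)
    ... | no ¬h = no (¬h ∘ proj₁)

  _≟ₑ_ : DecidableEquality Edge
  e ≟ₑ f = map′ (λ { (refl , refl) → refl }) (λ { refl → refl , refl })
                ((lower e Fin.≟ lower f) ×-dec (upper e Fin.≟ upper f))

  anyIndividual? : ∀ L {P : Individual L G → Set} → Decidable P → Dec (∃ P)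
  anyIndividual? MSO₁ P? = any? P?
  anyIndividual? MSO₂ P? = map′
    [ (λ (v , p) → inj₁ v , p) , (λ (e , p) → inj₂ e , p) ]′
    (λ { (inj₁ v , p) → inj₁ (v , p) ; (inj₂ e , p) → inj₂ (e , p) })
    (any? (P? ∘ inj₁) ⊎-dec anyEdge? (P? ∘ inj₂))

  SameMembers : ∀ L → SetOf L G → SetOf L G → Set
  SameMembers L X Y = ∀ x → Member L G x X ⇔ Member L G x Y

  -- Without function extensionality the type Edge → Bool cannot be enumerated
  -- up to _≡_, so sets of edges are searched for as sets of pairs of endpoints.
  fromPairs : Subset (order * order) → Edge → Bool
  fromPairs S e = lookup S (combine (lower e) (upper e))

  memberPair? : ∀ (X : Edge → Bool) ij →
                Dec (∃[ e ] combine (lower e) (upper e) ≡ ij × T (X e))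
  memberPair? X ij = anyEdge? λ e → (combine (lower e) (upper e) Fin.≟ ij) ×-dec T? (X e)

  toPairs : (Edge → Bool) → Subset (order * order)
  toPairs X = Vec.tabulate λ ij → ⌊ memberPair? X ij ⌋

  -- The encoding loses no members because `combine` is injective and an edge is determined by its
  -- endpoints.
  fromPairs-toPairs : ∀ X e → T (X e) ⇔ T (fromPairs (toPairs X) e)
  fromPairs-toPairs X e = mk⇔
    (λ Xe → subst T (sym looked-up) (fromWitness {a? = memberPair? X _} (e , refl , Xe)))
    (λ h → let e′ , eq , Xe′ = toWitness {a? = memberPair? X _} (subst T looked-up h)
           in subst (T ∘ X) (same-endpoints (combine-injective (lower e′) (upper e′) _ _ eq)) Xe′)
    where
    looked-up = lookup∘tabulate _ (combine (lower e) (upper e))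
    same-endpoints : ∀ {e′} → lower e′ ≡ lower e × upper e′ ≡ upper e → e′ ≡ e
    same-endpoints (refl , refl) = refl

  -- The search reaches each edge set only up to having the same members, so `P` has to respect that
  -- relation.
  anySet? : ∀ L {P : SetOf L G → Set} → (∀ {X Y} → SameMembers L X Y → P X → P Y) →
            Decidable P → Dec (∃ P)
  anySet? MSO₁ resp P? = anySubset? P?
  anySet? MSO₂ resp P? = map′
    [ (λ (X , p) → inj₁ X , p) , (λ (S , p) → inj₂ (fromPairs S) , p) ]′
    (λ { (inj₁ X , p) → inj₁ (X , p)
       ; (inj₂ X , p) → inj₂ (toPairs X , resp (λ { (inj₁ _) → ⇔-id _
                                                  ; (inj₂ e) → fromPairs-toPairs X e }) p) })
    (anySubset? (P? ∘ inj₁) ⊎-dec anySubset? (P? ∘ inj₂ ∘ fromPairs))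

  -- Formulas inspect sets only through membership; this supplies the invariance that `anySet?`
  -- demands.
  sat-resp : ∀ {ρ : Vec (Individual L G) m} {σ τ : Vec (SetOf L G) n} (φ : Formula L m n) →
             (∀ i → SameMembers L (lookup σ i) (lookup τ i)) →
             Satisfies G ρ σ φ ⇔ Satisfies G ρ τ φ
  sat-resp (E x y)  σ≈τ = ⇔-id _
  sat-resp (I x y)  σ≈τ = ⇔-id _
  sat-resp (x ∈′ i) σ≈τ = σ≈τ i _
  sat-resp (x ≡′ y) σ≈τ = ⇔-id _
  sat-resp (¬′ φ)   σ≈τ = let φ≈ = sat-resp φ σ≈τ in mk⇔ (_∘ from φ≈) (_∘ to φ≈)
  sat-resp (φ ∧′ ψ) σ≈τ = let φ≈ = sat-resp φ σ≈τ; ψ≈ = sat-resp ψ σ≈τ in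
    mk⇔ (λ (p , q) → to φ≈ p , to ψ≈ q) (λ (p , q) → from φ≈ p , from ψ≈ q)
  sat-resp (∃ᵢ φ)   σ≈τ = mk⇔ (λ (x , p) → x , to (sat-resp φ σ≈τ) p)
                              (λ (x , p) → x , from (sat-resp φ σ≈τ) p)
  sat-resp {L = L} {σ = σ} {τ} (∃ₛ φ) σ≈τ =
    mk⇔ (λ (X , p) → X , to (sat-resp φ (extend X)) p)
        (λ (X , p) → X , from (sat-resp φ (extend X)) p)
    where
    extend : ∀ X i → SameMembers L (lookup (X ∷ σ) i) (lookup (X ∷ τ) i)
    extend X zero    = λ _ → ⇔-id _
    extend X (suc i) = σ≈τ i

  member? : ∀ L x X → Dec (Member L G x X)
  member? MSO₁ v        X        = v ∈? X
  member? MSO₂ (inj₁ v) (inj₁ X) = v ∈? X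
  member? MSO₂ (inj₂ e) (inj₂ X) = T? (X e)
  member? MSO₂ (inj₁ _) (inj₂ _) = no id
  member? MSO₂ (inj₂ _) (inj₁ _) = no id

  incidence? : ∀ x y → Dec (Incidence G x y)
  incidence? (inj₁ v) (inj₂ e) = (v Fin.≟ lower e) ⊎-dec (v Fin.≟ upper e)
  incidence? (inj₁ _) (inj₁ _) = no id
  incidence? (inj₂ _) _        = no id

  individual≟ : ∀ L → DecidableEquality (Individual L G)
  individual≟ MSO₁ = Fin._≟_
  individual≟ MSO₂ = ≡-dec Fin._≟_ _≟ₑ_

  sat? : (φ : Formula L m n) → ∀ {ρ σ} → Dec (Satisfies G ρ σ φ)
  sat?         (E x y)  = T? _
  sat?         (I x y)  = incidence? _ _
  sat? {L = L} (x ∈′ i) = member? L _ _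
  sat? {L = L} (x ≡′ y) = individual≟ L _ _
  sat?         (¬′ φ)   = ¬? (sat? φ)
  sat?         (φ ∧′ ψ) = sat? φ ×-dec sat? ψ
  sat? {L = L} (∃ᵢ φ)   = anyIndividual? L λ x → sat? φ
  sat? {L = L} (∃ₛ φ)   = anySet? L
    (λ X≈Y → to (sat-resp φ λ { zero → X≈Y ; (suc _) _ → ⇔-id _ })) λ X → sat? φ

-- Semantics of the formulas

-- Reads the classical encoding of a guarded ∀ as a ∀ over the sort that the guard describes;
-- decidability of `Q` removes the double negation.
relativized : {A B : Set} {f : A → B} {P Q : B → Set} →
              (∀ x → P x ⇔ (∃[ a ] x ≡ f a)) → Decidable Q →
              (¬ (∃[ x ] P x × ¬ Q x)) ⇔ (∀ a → Q (f a))
relativized P⇔image Q? = mk⇔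
  (λ ¬bad a → decidable-stable (Q? _) λ ¬q → ¬bad (_ , from (P⇔image _) (a , refl) , ¬q))
  (λ { q (x , px , ¬q) → case to (P⇔image x) px of λ { (a , refl) → ¬q (q a) } })

module _ {G : Graph} where
  open Graph G

  vertex : ∀ L → Vertex → Individual L G
  vertex MSO₁ v = v
  vertex MSO₂ v = inj₁ v

  item : ∀ L → Item L G → Individual L G
  item MSO₁ v = v
  item MSO₂ e = inj₂ e

  label : ∀ L → Vertex → Edge → Item L G
  label MSO₁ u e = u
  label MSO₂ u e = e

  vertex-injective : ∀ L {u v} → vertex L u ≡ vertex L v → u ≡ v
  vertex-injective MSO₁ = id
  vertex-injective MSO₂ = inj₁-injective

  ⊤′-sat : ∀ {ρ : Vec (Individual L G) m} {σ : Vec (SetOf L G) n} → Satisfies {L} {m} {n} G ρ σ ⊤′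
  ⊤′-sat (x , x≢x) = x≢x refl

  ⋀-sat : ∀ {ρ : Vec (Individual L G) m} {σ : Vec (SetOf L G) n} (φs : List (Formula L m n)) →
          Satisfies {L} G ρ σ (⋀ φs) ⇔ All (Satisfies {L} G ρ σ) φs
  ⋀-sat {ρ = ρ} {σ} [] = mk⇔ (λ _ → []) (λ _ → ⊤′-sat {ρ = ρ} {σ})
  ⋀-sat (φ ∷ φs) = mk⇔ (λ (p , ps) → p ∷ to (⋀-sat φs) ps)
                       (λ { (p ∷ ps) → p , from (⋀-sat φs) ps })

  -- The encoding by negations says only that not all disjuncts fail; decidable satisfaction turns
  -- this into a disjunct that holds.
  ⋁-sat : ∀ {ρ : Vec (Individual L G) m} {σ : Vec (SetOf L G) n} (φs : List (Formula L m n)) →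
          Satisfies {L} G ρ σ (⋁ φs) ⇔ Any (Satisfies {L} G ρ σ) φs
  ⋁-sat {ρ = ρ} {σ = σ} φs = mk⇔
    (λ h → decidable-stable (Any.any? (λ φ → sat? φ) φs)
             λ ¬any → h (from (⋀-sat _) (All.map⁺ (All.¬Any⇒All¬ φs ¬any))))
    (λ any all → All.All¬⇒¬Any (All.map⁻ (to (⋀-sat (map ¬′_ φs)) all)) any)

  isItem-sat : ∀ {ρ : Vec (Individual L G) m} {σ : Vec (SetOf L G) n} x →
               Satisfies {L} G ρ σ (isItem x) ⇔ (∃[ o ] lookup ρ x ≡ item L o)
  isItem-sat {L = MSO₁} {ρ = ρ} {σ} x = mk⇔ (λ _ → lookup ρ x , refl) (λ _ → ⊤′-sat {ρ = ρ} {σ})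
  isItem-sat {L = MSO₂} {ρ = ρ} x with lookup ρ x
  ... | inj₁ v = mk⇔ (λ { (inj₁ _ , ()) ; (inj₂ _ , ()) }) (λ ())
  ... | inj₂ e = mk⇔ (λ _ → e , refl) (λ _ → inj₁ (lower e) , inj₁ refl)

  isVertex-sat : ∀ {ρ : Vec (Individual L G) m} {σ : Vec (SetOf L G) n} x →
                 Satisfies {L} G ρ σ (isVertex x) ⇔ (∃[ v ] lookup ρ x ≡ vertex L v)
  isVertex-sat {L = MSO₁} {ρ = ρ} {σ} x = mk⇔ (λ _ → lookup ρ x , refl) (λ _ → ⊤′-sat {ρ = ρ} {σ})
  isVertex-sat {L = MSO₂} {ρ = ρ} x with lookup ρ x
  ... | inj₁ v = mk⇔ (λ _ → v , refl) (λ { _ (inj₁ _ , ()) ; _ (inj₂ _ , ()) })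
  ... | inj₂ e = mk⇔ (λ ¬item → ⊥-elim (¬item (inj₁ (lower e) , inj₁ refl))) (λ ())

  ∀ᵥ-sat : ∀ {ρ : Vec (Individual L G) m} {σ : Vec (SetOf L G) n} (φ : Formula L (suc m) n) →
           Satisfies {L} G ρ σ (∀ᵥ φ) ⇔ (∀ v → Satisfies {L} G (vertex L v ∷ ρ) σ φ)
  ∀ᵥ-sat {L = L} φ = relativized (λ _ → isVertex-sat {L = L} zero) (λ _ → sat? φ)

  ∀ₒ-sat : ∀ {ρ : Vec (Individual L G) m} {σ : Vec (SetOf L G) n} (φ : Formula L (suc m) n) →
           Satisfies {L} G ρ σ (∀ₒ φ) ⇔ (∀ o → Satisfies {L} G (item L o ∷ ρ) σ φ)
  ∀ₒ-sat {L = L} φ = relativized (λ _ → isItem-sat {L = L} zero) (λ _ → sat? φ)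

  ∃ₛ^-sat : ∀ k {ρ : Vec (Individual L G) m} (φ : Formula L m k) →
            Satisfies {L} G ρ [] (∃ₛ^ k φ) ⇔ (∃[ σ ] Satisfies {L} G ρ σ φ)
  ∃ₛ^-sat zero    φ = mk⇔ ([] ,_) (λ { ([] , p) → p })
  ∃ₛ^-sat (suc k) φ = mk⇔
    (λ h → let σ , X , p = to (∃ₛ^-sat k (∃ₛ φ)) h in X ∷ σ , p)
    (λ { (X ∷ σ , p) → from (∃ₛ^-sat k (∃ₛ φ)) (σ , X , p) })

  adjacent⇒edge : ∀ {u v} → u ~ v → ∃[ e ] Joins e u v
  adjacent⇒edge {u} {v} u~v with <-cmp u v
  ... | tri< u<v _ _    = edge u v u<v u~v , inj₁ (refl , refl)
  ... | tri≈ _ refl _   = contradiction u~v (loopless u)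
  ... | tri> _ _ v<u    = edge v u v<u (symmetric u v u~v) , inj₂ (refl , refl)

  joins⇒adjacent : ∀ {u v} e → Joins e u v → u ~ v
  joins⇒adjacent (edge u v _ u~v) (inj₁ (refl , refl)) = recompute (T? _) u~v
  joins⇒adjacent (edge v u _ v~u) (inj₂ (refl , refl)) = symmetric v u (recompute (T? _) v~u)

  joins⇒≢ : ∀ {u v} e → Joins e u v → u ≢ v
  joins⇒≢ e j refl = loopless _ (joins⇒adjacent e j)

  -- The inequality excludes one endpoint counted twice, which is why `arrow` contains it for
  -- `MSO₂`.
  joins⇔incident : ∀ {u v} e → Joins e u v ⇔ ((Incident u e × Incident v e) × u ≢ v)
  joins⇔incident e = mk⇔
    (λ j → ends j , joins⇒≢ e j)
    (λ { ((inj₁ p , inj₁ q) , u≢v) → contradiction (trans p (sym q)) u≢v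
       ; ((inj₁ p , inj₂ q) , _)   → inj₁ (sym p , sym q)
       ; ((inj₂ p , inj₁ q) , _)   → inj₂ (sym q , sym p)
       ; ((inj₂ p , inj₂ q) , u≢v) → contradiction (trans p (sym q)) u≢v })
    where
    ends : ∀ {u v} → Joins e u v → Incident u e × Incident v e
    ends (inj₁ (p , q)) = inj₁ (sym p) , inj₂ (sym q)
    ends (inj₂ (p , q)) = inj₂ (sym q) , inj₁ (sym p)

  -- For `MSO₂`, incidence itself forces `o` to be an edge and `x` a vertex, so the variables
  -- quantified in `via` are sorted by the arrow.
  arrow-sat : ∀ {ρ : Vec (Individual L G) m} {σ : Vec (SetOf L G) n} {a u} o x →
              lookup ρ a ≡ vertex L u →
              Satisfies {L} G ρ σ (arrow a o x) ⇔
              (∃[ v ] ∃[ e ] Joins e u v ×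
                lookup ρ x ≡ vertex L v × lookup ρ o ≡ item L (label L u e))
  arrow-sat {L = MSO₁} {ρ = ρ} {a = a} o x refl = mk⇔
    (λ (o≡a , a~x) → let e , j = adjacent⇒edge a~x in lookup ρ x , e , j , refl , o≡a)
    (λ { (v , e , j , refl , o≡a) → o≡a , joins⇒adjacent e j })
  arrow-sat {L = MSO₂} {ρ = ρ} {a = a} o x a≡u with lookup ρ a | lookup ρ o | lookup ρ x | a≡u
  ... | _ | inj₁ _ | _      | refl = mk⇔ (λ { ((() , _) , _) }) (λ ())
  ... | _ | inj₂ e | inj₂ _ | refl = mk⇔ (λ { ((_ , ()) , _) }) (λ { (_ , _ , _ , () , _) })
  ... | _ | inj₂ e | inj₁ v | refl = mk⇔
    (λ (inc , u≢v) → v , e , from (joins⇔incident e) (inc , u≢v ∘ cong inj₁) , refl , refl)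
    (λ { (_ , _ , j , refl , refl) → let inc , u≢v = to (joins⇔incident e) j in
         inc , u≢v ∘ inj₁-injective })

  via-sat : ∀ {ρ : Vec (Individual L G) m} {σ : Vec (SetOf L G) n} {a u} φ →
            lookup ρ a ≡ vertex L u →
            Satisfies {L} G ρ σ (via a φ) ⇔
            (∃[ v ] ∃[ e ] Joins e u v ×
              Satisfies {L} G (vertex L v ∷ item L (label L u e) ∷ ρ) σ φ)
  via-sat {L = L} {ρ = ρ} {σ} {a} {u} φ a≡u = mk⇔
    (λ (o , x , a→x , p) →
       let v , e , j , x≡v , o≡e = to (arrow-sat {L = L} (suc zero) zero a≡u) a→x in
       v , e , j , subst (λ y → Satisfies {L} G (y ∷ item L (label L u e) ∷ ρ) σ φ) x≡v
                     (subst (λ y → Satisfies {L} G (x ∷ y ∷ ρ) σ φ) o≡e p))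
    (λ (v , e , j , p) →
       _ , _ , from (arrow-sat {L = L} (suc zero) zero a≡u) (v , e , j , refl , refl) , p)

  vertex-≡ : ∀ {x y u w} → x ≡ vertex L u → y ≡ vertex L w → (x ≡ y) ⇔ (u ≡ w)
  vertex-≡ {L = L} x≡u y≡w = mk⇔
    (λ x≡y → vertex-injective L (trans (sym x≡u) (trans x≡y y≡w)))
    (λ { refl → trans x≡u (sym y≡w) })

  walk-sat : ∀ l {ρ : Vec (Individual L G) m} {σ : Vec (SetOf L G) n} {a b u w} →
             lookup ρ a ≡ vertex L u → lookup ρ b ≡ vertex L w →
             Satisfies {L} G ρ σ (walk l a b) ⇔ (Σ (Walk G u w) λ p → walkLength p ≡ l)
  walk-sat {L = L} zero a≡u b≡w = mk⇔
    ((λ { refl → stop , refl }) ∘′ to (vertex-≡ {L = L} a≡u b≡w))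
    (λ { (stop , _) → from (vertex-≡ {L = L} a≡u b≡w) refl })
  walk-sat {L = L} (suc l) {b = b} a≡u b≡w = mk⇔
    (λ s → let v , e , j , s′ = to (via-sat {L = L} φ a≡u) s
               p , len        = to (walk-sat {L = L} l refl b≡w) s′ in
       step e j p , cong suc len)
    (λ { (stop , ())
       ; (step e j p , len) → from (via-sat {L = L} φ a≡u)
           (_ , e , j , from (walk-sat {L = L} l refl b≡w) (p , suc-injective len)) })
    where φ = walk l zero (suc (suc b))

  -- Rainbow conditions along walks.

  labels : ∀ L {u w} → Walk G u w → List (Item L G)
  labels L stop             = []
  labels L {u} (step e _ p) = label L u e ∷ labels L p

  labels-MSO₁ : ∀ {u w} (p : Walk G u w) → labels MSO₁ p ≡ departures p
  labels-MSO₁ stop             = refl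
  labels-MSO₁ {u} (step _ _ p) = cong (u ∷_) (labels-MSO₁ p)

  labels-MSO₂ : ∀ {u w} (p : Walk G u w) → labels MSO₂ p ≡ edges p
  labels-MSO₂ stop         = refl
  labels-MSO₂ (step e _ p) = cong (e ∷_) (labels-MSO₂ p)

  Apart : ∀ L → Vec (SetOf L G) n → Individual L G → Individual L G → Set
  Apart L σ x y = ∀ i → ¬ (Member L G x (lookup σ i) × Member L G y (lookup σ i))

  apart-sat : ∀ {ρ : Vec (Individual L G) m} {σ : Vec (SetOf L G) n} x y →
              Satisfies {L} G ρ σ (apart x y) ⇔ Apart L σ (lookup ρ x) (lookup ρ y)
  apart-sat x y = mk⇔ (All.tabulate⁻ ∘ to (⋀-sat _)) (from (⋀-sat _) ∘ All.tabulate⁺)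

  Rainbow : ∀ L → Vec (SetOf L G) n → List (Item L G) → Set
  Rainbow L σ = AllPairs (Apart L σ on item L)

  AllApart : ∀ L → Vec (Individual L G) m → Vec (SetOf L G) n → List (Fin m) → Item L G → Set
  AllApart L ρ σ us o = All (λ y → Apart L σ (lookup ρ y) (item L o)) us

  -- The statement is generalized over the accumulator `us`, so that the induction can compare the
  -- labels still to come with those already seen.
  labelRainbow-sat : ∀ l us {ρ : Vec (Individual L G) m} {σ : Vec (SetOf L G) n} {a b u w} →
    lookup ρ a ≡ vertex L u → lookup ρ b ≡ vertex L w →
    Satisfies {L} G ρ σ (labelRainbow l us a b) ⇔
    (Σ (Walk G u w) λ p → walkLength p ≡ l × Rainbow L σ (labels L p) ×
                          All (AllApart L ρ σ us) (labels L p))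
  labelRainbow-sat {L = L} zero us a≡u b≡w = mk⇔
    ((λ { refl → stop , refl , [] , [] }) ∘′ to (vertex-≡ {L = L} a≡u b≡w))
    (λ { (stop , _) → from (vertex-≡ {L = L} a≡u b≡w) refl })
  labelRainbow-sat {L = L} (suc l) us {ρ} {σ} {b = b} a≡u b≡w = mk⇔
    (λ s → let v , e , j , fresh , s′ = to (via-sat {L = L} φ a≡u) s
               p , len , rb , all     = to (labelRainbow-sat {L = L} l _ refl b≡w) s′
               -- Splits off the label just accumulated: its comparisons become the head of the
               -- pairwise condition, and the others are inherited from earlier steps.
               new , old              = All.unzipWith (λ { (q ∷ qs) → q , All.map⁻ qs }) all in
       step e j p , cong suc len , new ∷ rb , to freshness fresh ∷ old)
    (λ { (stop , () , _)
       ; (step e j p , len , (new ∷ rb) , (fresh ∷ old)) → from (via-sat {L = L} φ a≡u)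
           ( _ , e , j , from freshness fresh
           , from (labelRainbow-sat {L = L} l _ refl b≡w)
               (p , suc-injective len , rb
               , All.zipWith (λ (q , qs) → q ∷ All.map⁺ qs) (new , old))) })
    where
    us′ = map (λ y → suc (suc y)) us
    φ = ⋀ (map (λ y → apart y (suc zero)) us′) ∧′ labelRainbow l (suc zero ∷ us′) zero (suc (suc b))
    freshness : ∀ {x o} →
      Satisfies {L} G (x ∷ item L o ∷ ρ) σ (⋀ (map (λ y → apart y (suc zero)) us′)) ⇔
      AllApart L ρ σ us o
    freshness = mk⇔
      (All.map (λ {y} → to (apart-sat {L = L} (suc (suc y)) (suc zero))) ∘
        All.map⁻ ∘ All.map⁻ ∘ to (⋀-sat _))
      (from (⋀-sat _) ∘ All.map⁺ ∘ All.map⁺ ∘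
        All.map (λ {y} → from (apart-sat {L = L} (suc (suc y)) (suc zero))))

  rainbow-sat : ∀ l {ρ : Vec (Individual L G) m} {σ : Vec (SetOf L G) n} {a b u w} →
    lookup ρ a ≡ vertex L u → lookup ρ b ≡ vertex L w →
    Satisfies {L} G ρ σ (rainbow l a b) ⇔
    (Σ (Walk G u w) λ p → walkLength p ≡ l × Rainbow L σ (coloured L p))
  rainbow-sat {L = MSO₁} zero a≡u b≡w = mk⇔
    ((λ { refl → stop , refl , [] }) ∘′ to (vertex-≡ {L = MSO₁} a≡u b≡w))
    (λ { (stop , _) → from (vertex-≡ {L = MSO₁} a≡u b≡w) refl })
  rainbow-sat {L = MSO₁} (suc l) {σ = σ} {b = b} a≡u b≡w = mk⇔
    (λ s → let v , e , j , s′ = to (via-sat {L = MSO₁} φ a≡u) s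
               p , len , rb , _ = to (labelRainbow-sat {L = MSO₁} l [] refl b≡w) s′ in
       step e j p , cong suc len , subst (Rainbow MSO₁ σ) (labels-MSO₁ p) rb)
    (λ { (stop , () , _)
       ; (step e j p , len , rb) → from (via-sat {L = MSO₁} φ a≡u)
           ( _ , e , j , from (labelRainbow-sat {L = MSO₁} l [] refl b≡w)
               (p , suc-injective len , subst (Rainbow MSO₁ σ) (sym (labels-MSO₁ p)) rb
               , All.universal (λ _ → []) _)) })
    where φ = labelRainbow l [] zero (suc (suc b))
  rainbow-sat {L = MSO₂} l {σ = σ} a≡u b≡w = mk⇔
    (λ s → let p , len , rb , _ = to (labelRainbow-sat {L = MSO₂} l [] a≡u b≡w) s in
       p , len , subst (Rainbow MSO₂ σ) (labels-MSO₂ p) rb)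
    (λ (p , len , rb) → from (labelRainbow-sat {L = MSO₂} l [] a≡u b≡w)
       (p , len , subst (Rainbow MSO₂ σ) (sym (labels-MSO₂ p)) rb , All.universal (λ _ → []) _))

  ShortestRainbowWalk : ∀ L → Vec (SetOf L G) n → (u w : Vertex) → Walk G u w → Set
  ShortestRainbowWalk L σ u w p =
    Rainbow L σ (coloured L p) × (∀ (q : Walk G u w) → walkLength p ≤ walkLength q)

  shortestRainbow-sat : ∀ l {ρ : Vec (Individual L G) m} {σ : Vec (SetOf L G) n} {a b u w} →
    lookup ρ a ≡ vertex L u → lookup ρ b ≡ vertex L w →
    Satisfies {L} G ρ σ (shortestRainbow l a b) ⇔
    (Σ (Walk G u w) λ p → walkLength p ≡ l × ShortestRainbowWalk L σ u w p)
  shortestRainbow-sat {L = L} l {ρ} {σ} {a} {b} a≡u b≡w = mk⇔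
    (λ (s , none) → let p , len , rb = to (rainbow-sat {L = L} l a≡u b≡w) s in
       -- A shorter walk would satisfy the formula negated at the index equal to its own length.
       p , len , rb , λ q → ≮⇒≥ λ q<p → let q<l = subst (_ ℕ.<_) len q<p in
         All.tabulate⁻ (to (⋀-sat φs) none) (fromℕ< q<l)
           (from (walk-sat {L = L} _ a≡u b≡w) (q , sym (toℕ-fromℕ< q<l))))
    (λ { (p , refl , rb , min) →
         from (rainbow-sat {L = L} l a≡u b≡w) (p , refl , rb)
       , from (⋀-sat φs) (All.tabulate⁺ λ i s →
           let q , q≡i = to (walk-sat {L = L} _ a≡u b≡w) s in
           <⇒≱ (toℕ<n i) (subst (walkLength p ≤_) q≡i (min q))) })
    where φs = tabulate {n = l} λ i → ¬′ walk (toℕ i) a b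

  -- The sentence and colorability.

  sentence-sat : ∀ L k → (G ⊨ sentence L k) ⇔
    (∃[ σ ] (∀ o → ∃[ i ] Member L G (item L o) (lookup {n = k} σ i)) ×
            (∀ u w → ∃[ p ] walkLength p ≤ suc k × ShortestRainbowWalk L σ u w p))
  sentence-sat L k = mk⇔
    (λ s → let σ , cov , prs = to (∃ₛ^-sat {L = L} k ((∀ₒ ⋁ cs) ∧′ (∀ᵥ (∀ᵥ ⋁ ps)))) s in
       σ , (λ o → Any.tabulate⁻ {f = c} (to (⋁-sat cs) (to (∀ₒ-sat (⋁ cs)) cov o)))
         , λ u w →
             let prs-u-w      = to (∀ᵥ-sat (⋁ ps)) (to (∀ᵥ-sat (∀ᵥ (⋁ ps))) prs u) w
                 l , s′       = Any.tabulate⁻ {f = sr} (to (⋁-sat ps) prs-u-w)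
                 p , len , sp = to (shortestRainbow-sat {L = L} (toℕ l) refl refl) s′ in
             p , subst (_≤ suc k) (sym len) (s≤s⁻¹ (toℕ<n l)) , sp)
    (λ (σ , cov , prs) → from (∃ₛ^-sat {L = L} k ((∀ₒ ⋁ cs) ∧′ (∀ᵥ (∀ᵥ ⋁ ps))))
       ( σ
       , from (∀ₒ-sat (⋁ cs)) (λ o → let i , h = cov o in
           from (⋁-sat cs) (Any.tabulate⁺ {f = c} i h))
       , from (∀ᵥ-sat (∀ᵥ (⋁ ps))) λ u → from (∀ᵥ-sat (⋁ ps)) λ w →
           -- The lengths 0 to k + 1 give k + 2 disjuncts, so the length of `p` is a valid index.
           let p , len , sp = prs u w; l<2+k = s≤s len in
           from (⋁-sat ps) (Any.tabulate⁺ {f = sr} (fromℕ< l<2+k)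
             (from (shortestRainbow-sat {L = L} _ refl refl) (p , sym (toℕ-fromℕ< l<2+k) , sp)))))
    where
    c : Fin k → Formula L 1 k
    c i = zero ∈′ i
    cs = inColour k
    sr : Fin (suc (suc k)) → Formula L 2 k
    sr l = shortestRainbow (toℕ l) (suc zero) zero
    ps = shortestRainbows k

  fibre : ∀ L → (Item L G → Fin k) → Fin k → SetOf L G
  fibre MSO₁ α i = Vec.tabulate λ v → ⌊ α v Fin.≟ i ⌋
  fibre MSO₂ α i = inj₂ λ e → ⌊ α e Fin.≟ i ⌋

  fibre-member : ∀ L (α : Item L G → Fin k) i o →
                 Member L G (item L o) (fibre L α i) ⇔ (α o ≡ i)
  fibre-member MSO₁ α i v = mk⇔
    (λ v∈ → toWitness (subst T (trans (sym ([]=⇒lookup v∈)) (lookup∘tabulate _ v)) _))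
    (λ αv≡i → lookup⇒[]= v _ (trans (lookup∘tabulate _ v) (to T-≡ (fromWitness αv≡i))))
  fibre-member MSO₂ α i e = mk⇔ toWitness fromWitness

  sentence⇔colourable : ∀ L k → (G ⊨ sentence L k) ⇔ Colourable L G k
  sentence⇔colourable L k = mk⇔ colour uncolour ⇔-∘ sentence-sat L k
    where
    colour : _ → Colourable L G k
    -- Each item takes the index of the set chosen to cover it. Equal colors would put two items
    -- into a common set, contrary to apartness.
    colour (σ , cov , prs) = proj₁ ∘ cov , λ u w → let p , _ , rb , min = prs u w in
      p , from (IsShortestPath⇔shortestWalk p) min
        , AllPairs.map⁺ (AllPairs.map (λ {o} {o′} ap eq →
            let i , o∈ = cov o; _ , o′∈ = cov o′ in
            ap i (o∈ , subst (λ i → Member L G (item L o′) (lookup σ i)) (sym eq) o′∈)) rb)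
    uncolour : Colourable L G k → _
    uncolour (α , strong) = σ , (λ o → α o , from (member (α o) o) refl)
      , λ u w → let p , shortest , unique = strong u w in
          -- The colors along `p` are distinct, so by the pigeonhole principle at most k items are
          -- colored and the length stays within the cutoff.
          p , ≤-trans (length≤1+coloured L p)
                (s≤s (subst (_≤ k) (length-map α (coloured L p)) (Unique⇒length≤ _ unique)))
            , AllPairs.map (λ αo≢αo′ i (o∈ , o′∈) →
                αo≢αo′ (trans (to (member i _) o∈) (sym (to (member i _) o′∈))))
                (AllPairs.map⁻ unique)
            , to (IsShortestPath⇔shortestWalk p) shortest
      where
      σ = Vec.tabulate (fibre L α)
      member : ∀ i o → Member L G (item L o) (lookup σ i) ⇔ (α o ≡ i)
      member i o rewrite lookup∘tabulate (fibre L α) i = fibre-member L α i o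

  -- Least number of colors.

  colourable-mono : ∀ L {i j} → i ≤ j → Colourable L G i → Colourable L G j
  colourable-mono L i≤j (α , strong) = (λ o → inject≤ (α o) i≤j) , λ u w →
    let p , shortest , unique = strong u w in
    p , shortest
      , AllPairs.map⁺ (AllPairs.map (_∘ inject≤-injective i≤j i≤j _ _) (AllPairs.map⁻ unique))

-- Strong induction: as long as a smaller witness exists, descend to it. Decidability makes this
-- search constructive.
minimum : {P : ℕ → Set} → Decidable P → ∀ k → P k → ∃[ i ] IsMinimum P i × i ≤ k
minimum {P} P? = <-rec _ least
  where
  least : ∀ k → (∀ {j} → j ℕ.< k → P j → ∃[ i ] IsMinimum P i × i ≤ j) →
          P k → ∃[ i ] IsMinimum P i × i ≤ k
  least k rec pk with anyUpTo? P? k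
  ... | yes (j , j<k , pj) = let i , min , i≤j = rec j<k pj in i , min , ≤-trans i≤j (<⇒≤ j<k)
  ... | no  none           = k , (pk , λ j pj → ≮⇒≥ λ j<k → none (j , j<k , pj)) , ≤-refl

sentence-correct : ∀ L k G → (G ⊨ sentence L k) ⇔ YesInstance L k G
sentence-correct L k G = mk⇔
  yes-instance
  (λ (_ , i , (colourable , _) , i≤k) → colourable-mono L i≤k colourable)
  ⇔-∘ sentence⇔colourable L k
  where
  -- Colorability is decided by model checking the sentence for i colors, which is already known to
  -- express it.
  colourable? : Decidable (Colourable L G)
  colourable? i = Dec.map (sentence⇔colourable L i) (sat? (sentence L i))
  yes-instance : Colourable L G k → YesInstance L k G
  yes-instance (α , strong) =
      (λ u w → let p , (path , _) , _ = strong u w in p , path)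
    , minimum colourable? k (α , strong)

lemma8 : ((k : ℕ) → Σ (Sentence MSO₁) (λ φ → (G : Graph) → (G ⊨ φ) ⇔ SRVC k G))
    × ((k : ℕ) → Σ (Sentence MSO₂) (λ ψ → (G : Graph) → (G ⊨ ψ) ⇔ SRC k G))
lemma8 = (λ k → sentence MSO₁ k , sentence-correct MSO₁ k)
       , (λ k → sentence MSO₂ k , sentence-correct MSO₂ k)
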